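{- Let $H$ be a (nonempty) perfect graph and let $f:V(H)\to\mathbb{Q}^{+}$ be a weight function assigning a positive rational number to each vertex. Then $$\omega(H)\ \ge\ \left\lceil \frac{f(V(H))}{\alpha_f(H)}\right\rceil .$$
   Context: Graphs are finite and simple. A graph $G$ is perfect if $\chi(G')=\omega(G')$ for every induced subgraph $G'$ of $G$, where $\chi$ is the chromatic number and $\omega$ the clique number. For $A\subseteq V(H)$, $f(A)=\sum_{v\in A}f(v)$. The weighted independence number of $H$ relative to $f$ is $\alpha_f(H)=\max\{f(A): A \text{ is an independent set in } H\}$. -}

module Defs where

open import Data.Bool.Base using (if_then_else_)
open import Data.Fin.Base using (Fin; zero; suc; finToFun; funToFin)
open import Data.Fin.Properties using (all?; any?; finToFun-funToFin) renaming (_≟_ to _≟ᶠ_)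
open import Data.Fin.Subset using (Subset; inside; outside; _∈_; ⁅_⁆; ∣_∣) renaming (⊥ to ∅)
open import Data.Fin.Subset.Properties using (_∈?_; ∉⊥; x∈⁅y⁆⇒x≡y)
open import Data.List.Base using (List; []; _∷_; _++_; map; filter; upTo)
import Data.List.Extrema as Extrema
import Data.List.Extrema.Nat as ℕExt
open import Data.List.Membership.Propositional using () renaming (_∈_ to _∈ˡ_)
open import Data.List.Membership.Propositional.Properties
  using (∈-map⁺; ∈-++⁺ˡ; ∈-++⁺ʳ; ∈-filter⁺; ∈-upTo⁺)
open import Data.List.Relation.Unary.All using (lookup)
open import Data.List.Relation.Unary.All.Properties using (all-filter)
open import Data.List.Relation.Unary.Any using (here)
open import Data.Nat.Base as ℕ using (ℕ; zero; suc)
import Data.Nat.Properties as ℕ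
open import Data.Product.Base using (∃; _,_)
open import Data.Rational.Base as ℚ using (ℚ; 0ℚ; NonZero; Positive; NonNegative)
import Data.Rational.Properties as ℚ
open import Algebra.Properties.CommutativeMonoid.Sum ℚ.+-0-commutativeMonoid using (sum)
import Data.Vec.Base as Vec
open import Function.Base using (_on_; _∘_; id)
open import Function.Bundles using (_↣_; module Injection)
open import Level using (0ℓ)
open import Relation.Binary.Bundles using (DecTotalOrder)
open import Relation.Binary.Core using (Rel)
open import Relation.Binary.Definitions using (Symmetric; Irreflexive; Decidable)
open import Relation.Binary.PropositionalEquality.Core using (_≡_; _≢_; refl; sym; trans)
open import Relation.Nullary using (Dec; yes; no; ¬_; ¬?; contradiction)
open import Relation.Nullary.Decidable using (map′; _→-dec_)

private
  module ℚExt = Extrema (DecTotalOrder.totalOrder ℚ.≤-decTotalOrder)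

private
  variable
    m n : ℕ

record Graph (n : ℕ) : Set₁ where
  field
    Adj    : Rel (Fin n) 0ℓ
    adj?   : Decidable Adj
    symm   : Symmetric Adj
    irrefl : Irreflexive _≡_ Adj

open Graph public

-- The subgraph induced on the image of ι, with vertices renamed along ι.
induced : Graph n → Fin m ↣ Fin n → Graph m
induced G ι = record
  { Adj    = Adj G on to
  ; adj?   = λ x y → adj? G (to x) (to y)
  ; symm   = symm G
  ; irrefl = λ { refl → irrefl G refl }
  }
  where open Injection ι using (to)

IsClique : Graph n → Subset n → Set
IsClique G C = ∀ x y → x ∈ C → y ∈ C → x ≢ y → Adj G x y

IsIndependent : Graph n → Subset n → Set
IsIndependent G A = ∀ x y → x ∈ A → y ∈ A → ¬ Adj G x y

Colourable : Graph n → ℕ → Set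
Colourable {n} G k = ∃ λ (c : Fin n → Fin k) → ∀ x y → Adj G x y → c x ≢ c y

isClique? : (G : Graph n) (C : Subset n) → Dec (IsClique G C)
isClique? G C = all? λ x → all? λ y →
  (x ∈? C) →-dec ((y ∈? C) →-dec (¬? (x ≟ᶠ y) →-dec adj? G x y))

isIndependent? : (G : Graph n) (A : Subset n) → Dec (IsIndependent G A)
isIndependent? G A = all? λ x → all? λ y →
  (x ∈? A) →-dec ((y ∈? A) →-dec ¬? (adj? G x y))

-- Vertex maps Fin n → Fin k are searched through their codes in Fin (k ^ n).
colourable? : (G : Graph n) (k : ℕ) → Dec (Colourable G k)
colourable? {n} G k = map′ decode encode
  (any? λ i → all? λ x → all? λ y →
    adj? G x y →-dec ¬? (finToFun {k} {n} i x ≟ᶠ finToFun i y))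
  where
  decode : ∃ (λ i → ∀ x y → Adj G x y → finToFun {k} {n} i x ≢ finToFun i y) → Colourable G k
  decode (i , p) = finToFun i , p

  encode : Colourable G k → ∃ (λ i → ∀ x y → Adj G x y → finToFun {k} {n} i x ≢ finToFun i y)
  encode (c , p) = funToFin c , λ x y xy eq →
    p x y xy (trans (sym (finToFun-funToFin c x)) (trans eq (finToFun-funToFin c y)))

subsets : ∀ n → List (Subset n)
subsets zero    = Vec.[] ∷ []
subsets (suc n) = map (inside Vec.∷_) (subsets n) ++ map (outside Vec.∷_) (subsets n)

∈-subsets : (A : Subset n) → A ∈ˡ subsets n
∈-subsets Vec.[] = here refl
∈-subsets (inside Vec.∷ A) = ∈-++⁺ˡ (∈-map⁺ (inside Vec.∷_) (∈-subsets A))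
∈-subsets {suc n} (outside Vec.∷ A) =
  ∈-++⁺ʳ (map (inside Vec.∷_) (subsets n)) (∈-map⁺ (outside Vec.∷_) (∈-subsets A))

weight : (Fin n → ℚ) → Subset n → ℚ
weight f A = sum λ v → if Vec.lookup A v then f v else 0ℚ

-- In the two maxima below the default value ∅ is itself a clique and an
-- independent set; in χ the default value n is the number of colours of the
-- colouring giving each vertex its own colour.

maxClique : Graph n → Subset n
maxClique {n} G = ℕExt.argmax ∣_∣ ∅ (filter (isClique? G) (subsets n))

ω : Graph n → ℕ
ω G = ∣ maxClique G ∣

maxIndependent : (Fin n → ℚ) → Graph n → Subset n
maxIndependent {n} f G = ℚExt.argmax (weight f) ∅ (filter (isIndependent? G) (subsets n))

α : (Fin n → ℚ) → Graph n → ℚ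
α f G = weight f (maxIndependent f G)

χ : Graph n → ℕ
χ {n} G = ℕExt.min n (filter (colourable? G) (upTo n))

-- Every vertex subset is the image of an injection from some Fin m, and the
-- induced subgraph does not depend on that injection up to isomorphism.
Perfect : Graph n → Set
Perfect {n} G = ∀ {m} (ι : Fin m ↣ Fin n) → χ (induced G ι) ≡ ω (induced G ι)

maxClique-isClique : (G : Graph n) → IsClique G (maxClique G)
maxClique-isClique {n} G = ℕExt.argmax-all ∣_∣ {P = IsClique G}
  (λ _ _ x∈∅ → contradiction x∈∅ ∉⊥) (all-filter (isClique? G) (subsets n))

∣clique∣≤ω : (G : Graph n) {C : Subset n} → IsClique G C → ∣ C ∣ ℕ.≤ ω G
∣clique∣≤ω {n} G {C} cl = lookup (ℕExt.f[xs]≤f[argmax] ∅ (filter (isClique? G) (subsets n)))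
  (∈-filter⁺ (isClique? G) (∈-subsets C) cl)

maxIndependent-isIndependent : (f : Fin n → ℚ) (G : Graph n) →
                               IsIndependent G (maxIndependent f G)
maxIndependent-isIndependent {n} f G = ℚExt.argmax-all (weight f) {P = IsIndependent G}
  (λ _ _ x∈∅ → contradiction x∈∅ ∉⊥) (all-filter (isIndependent? G) (subsets n))

weight≤α : (f : Fin n → ℚ) (G : Graph n) {A : Subset n} → IsIndependent G A →
           weight f A ℚ.≤ α f G
weight≤α {n} f G {A} ind =
  lookup (ℚExt.f[xs]≤f[argmax] ∅ (filter (isIndependent? G) (subsets n)))
    (∈-filter⁺ (isIndependent? G) (∈-subsets A) ind)

χ-colourable : (G : Graph n) → Colourable G (χ G)
χ-colourable {n} G = ℕExt.argmin-all id {P = Colourable G}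
  (id , λ { x y xy refl → irrefl G refl xy }) (all-filter (colourable? G) (upTo n))

χ≤ : (G : Graph n) {k : ℕ} → Colourable G k → χ G ℕ.≤ k
χ≤ {n} G {k} col with k ℕ.<? n
... | yes k<n = lookup (ℕExt.min≤xs n (filter (colourable? G) (upTo n)))
                  (∈-filter⁺ (colourable? G) (∈-upTo⁺ k<n) col)
... | no  k≮n = ℕ.≤-trans (ℕExt.min≤⊤ n (filter (colourable? G) (upTo n))) (ℕ.≮⇒≥ k≮n)

weight-nonNeg : (f : Fin n → ℚ) → (∀ v → 0ℚ ℚ.< f v) → ∀ A → NonNegative (weight f A)
weight-nonNeg f f>0 Vec.[] = _
weight-nonNeg f f>0 (inside Vec.∷ A) = ℚ.nonNeg+nonNeg⇒nonNeg
  (f zero) {{ℚ.nonNegative (ℚ.<⇒≤ (f>0 zero))}}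
  (weight (f ∘ suc) A) {{weight-nonNeg (f ∘ suc) (f>0 ∘ suc) A}}
weight-nonNeg f f>0 (outside Vec.∷ A) = ℚ.nonNeg+nonNeg⇒nonNeg
  0ℚ (weight (f ∘ suc) A) {{weight-nonNeg (f ∘ suc) (f>0 ∘ suc) A}}

α-nonZero : .{{_ : ℕ.NonZero n}} (f : Fin n → ℚ) → (∀ v → 0ℚ ℚ.< f v) →
            (G : Graph n) → NonZero (α f G)
α-nonZero {suc n} f f>0 G = ℚ.>-nonZero (ℚ.<-≤-trans (ℚ.positive⁻¹ _ {{pos}}) (weight≤α f G ind))
  where
  ind : IsIndependent G ⁅ zero ⁆
  ind x y x∈ y∈ = irrefl G (trans (x∈⁅y⁆⇒x≡y zero x∈) (sym (x∈⁅y⁆⇒x≡y zero y∈)))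

  pos : Positive (weight f ⁅ zero ⁆)
  pos = ℚ.pos+nonNeg⇒pos (f zero) {{ℚ.positive (f>0 zero)}} (weight (f ∘ suc) ∅)
          {{weight-nonNeg (f ∘ suc) (f>0 ∘ suc) ∅}}

{-# OPTIONS --safe #-}
module Submission where

-- Perfection gives a proper colouring with χ(H) = ω(H) colours. Each colour
-- class is independent, so it weighs at most α_f(H), and summing over the
-- classes yields f(V(H)) ≤ ω(H) · α_f(H).

open import Data.Bool.Base using (true; if_then_else_)
open import Data.Fin.Base using (Fin; zero; suc)
open import Data.Fin.Properties using (_≟_)
open import Data.Fin.Subset using (Subset; ⊤; _∈_)
open import Data.Integer.Base as ℤ using (+_; _≥_)
open import Data.Integer.DivMod using (div-pos-is-/ℕ; n<s[n/ℕd]*d)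
import Data.Integer.Properties as ℤ
open import Data.Nat.Base using (ℕ; NonZero; zero; suc)
import Data.Nat.Coprimality as Coprimality
open import Data.Product.Base using (_,_)
open import Data.Rational.Base
  using (ℚ; 0ℚ; 1ℚ; mkℚ; ↥_; ↧_; ↧ₙ_; *≤*; _≤_; _<_; _+_; _*_; _/_; _÷_; 1/_; -_;
         floor; ceiling; Positive)
import Data.Rational.Properties as ℚ
open import Algebra.Properties.CommutativeMonoid.Sum ℚ.+-0-commutativeMonoid
  using (sum; ∑-comm; sum-cong-≗; sum-replicate-zero)
open import Data.Vec.Base using (lookup; tabulate)
open import Data.Vec.Properties using (lookup∘tabulate; lookup-replicate; []=⇒lookup)
open import Function.Base using (_∘_)
open import Function.Construct.Identity using (↣-id)
open import Relation.Binary.PropositionalEquality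
  using (_≡_; refl; sym; trans; cong; subst; module ≡-Reasoning)
open import Relation.Nullary using (does; yes; no)
open import Defs

-- A colouring with `ω H` colours comes from perfection (`perfect⇒ω-colourable`). Its classes
-- partition the vertices (`weight-⊤`) and are independent, which bounds the total weight by
-- `fromℕ (ω H) * α f H` (`weight≤colours*α`). As `α f H` is positive, one may divide by it
-- (`p≤q*r⇒p÷r≤q`); as `ω H` is an integer, the bound passes to the ceiling (`ceiling≤`).

private
  variable
    k n : ℕ

fromℕ : ℕ → ℚ
fromℕ k = mkℚ (+ k) 0 (Coprimality.sym (Coprimality.1-coprimeTo k))

fromℕ-suc : ∀ k → fromℕ (suc k) ≡ 1ℚ + fromℕ k
fromℕ-suc k = begin
  fromℕ (suc k)            ≡⟨ ℚ.↥p/↧p≡p (fromℕ (suc k)) ⟨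
  (+ 1 ℤ.+ + k) / 1        ≡⟨ cong (λ z → (+ 1 ℤ.+ z) / 1) (ℤ.*-identityʳ (+ k)) ⟨
  1ℚ + fromℕ k             ∎
  where open ≡-Reasoning

-- The floor is the integer quotient `q`, and the numerator lies strictly below `(q + 1) * ↧ p`.
-- Cancelling the positive denominator leaves `z < q + 1`.
≤floor : ∀ z p → z ℤ.* ↧ p ℤ.≤ ↥ p → z ℤ.≤ floor p
≤floor z p@record{} z≤p = begin
  z                   ≤⟨ ℤ.i<j⇒i≤pred[j] (ℤ.*-cancelʳ-<-nonNeg {j = ℤ.suc q} (↧ p)
                           (ℤ.≤-<-trans z≤p (n<s[n/ℕd]*d (↥ p) (↧ₙ p)))) ⟩
  ℤ.pred (ℤ.suc q)    ≡⟨ ℤ.pred-suc q ⟩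
  q                   ≡⟨ div-pos-is-/ℕ (↥ p) (↧ₙ p) ⟨
  floor p             ∎
  where
  open ℤ.≤-Reasoning
  q = ↥ p ℤ./ℕ ↧ₙ p

-- `ceiling p` unfolds to minus the floor of `- p`, so this is `≤floor` at `- k` and `- p`, negated.
ceiling≤ : ∀ k p → p ≤ fromℕ k → ceiling p ℤ.≤ + k
ceiling≤ k p@record{} (*≤* p≤k) = subst (ceiling p ℤ.≤_) (ℤ.neg-involutive (+ k))
  (ℤ.neg-mono-≤ (≤floor (ℤ.- + k) (- p) (begin
    ℤ.- + k ℤ.* ↧ (- p)  ≡⟨ cong (ℤ.- + k ℤ.*_) (ℚ.↧-neg p) ⟩
    ℤ.- + k ℤ.* ↧ p      ≡⟨ ℤ.neg-distribˡ-* (+ k) (↧ p) ⟨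
    ℤ.- (+ k ℤ.* ↧ p)    ≤⟨ ℤ.neg-mono-≤ p≤k ⟩
    ℤ.- (↥ p ℤ.* + 1)    ≡⟨ cong ℤ.-_ (ℤ.*-identityʳ (↥ p)) ⟩
    ℤ.- ↥ p              ≡⟨ ℚ.↥-neg p ⟨
    ↥ (- p)              ∎)))
  where open ℤ.≤-Reasoning

sum≤fromℕ* : ∀ (g : Fin k → ℚ) a → (∀ i → g i ≤ a) → sum g ≤ fromℕ k * a
sum≤fromℕ* {zero}  g a g≤a = ℚ.≤-reflexive (sym (ℚ.*-zeroˡ a))
sum≤fromℕ* {suc k} g a g≤a = begin
  g zero + sum (g ∘ suc)   ≤⟨ ℚ.+-mono-≤ (g≤a zero) (sum≤fromℕ* (g ∘ suc) a (g≤a ∘ suc)) ⟩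
  a + fromℕ k * a          ≡⟨ cong (_+ fromℕ k * a) (ℚ.*-identityˡ a) ⟨
  1ℚ * a + fromℕ k * a     ≡⟨ ℚ.*-distribʳ-+ a 1ℚ (fromℕ k) ⟨
  (1ℚ + fromℕ k) * a       ≡⟨ cong (_* a) (fromℕ-suc k) ⟨
  fromℕ (suc k) * a        ∎
  where open ℚ.≤-Reasoning

sum-indicator : ∀ (j : Fin k) a → sum (λ i → if does (j ≟ i) then a else 0ℚ) ≡ a
sum-indicator {suc k} zero    a = trans (cong (λ s → a + s) (sum-replicate-zero k)) (ℚ.+-identityʳ a)
-- On two successors `does (_ ≟ _)` reduces to the test on their predecessors, so the tail is the
-- induction hypothesis.
sum-indicator {suc k} (suc j) a = trans (ℚ.+-identityˡ _) (sum-indicator j a)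

fibre : (Fin n → Fin k) → Fin k → Subset n
fibre c i = tabulate λ v → does (c v ≟ i)

∈fibre⇒≡ : (c : Fin n → Fin k) {i : Fin k} {v : Fin n} → v ∈ fibre c i → c v ≡ i
∈fibre⇒≡ c {i} {v} v∈
  with c v ≟ i | trans (sym (lookup∘tabulate (λ u → does (c u ≟ i)) v)) ([]=⇒lookup v∈)
... | yes eq | _  = eq
... | no  _  | ()

-- Double counting: `f v` is spread over all colours, nonzero only at `c v`, and the two sums are
-- exchanged.
weight-⊤ : (f : Fin n → ℚ) (c : Fin n → Fin k) → weight f ⊤ ≡ sum (λ i → weight f (fibre c i))
weight-⊤ {n} {k} f c = begin
  weight f ⊤
    ≡⟨ sum-cong-≗ (λ v → cong (if_then f v else 0ℚ) (lookup-replicate v true)) ⟩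
  sum f
    ≡⟨ sum-cong-≗ (λ v → sum-indicator (c v) (f v)) ⟨
  sum (λ v → sum λ i → if does (c v ≟ i) then f v else 0ℚ)
    ≡⟨ ∑-comm (λ v i → if does (c v ≟ i) then f v else 0ℚ) ⟩
  sum (λ i → sum λ v → if does (c v ≟ i) then f v else 0ℚ)
    ≡⟨ sum-cong-≗ (λ i → sum-cong-≗ λ v →
         cong (if_then f v else 0ℚ) (lookup∘tabulate (λ u → does (c u ≟ i)) v)) ⟨
  sum (λ i → weight f (fibre c i))
    ∎
  where open ≡-Reasoning

weight≤colours*α : (f : Fin n → ℚ) (G : Graph n) → Colourable G k →
                   weight f ⊤ ≤ fromℕ k * α f G
weight≤colours*α f G (c , proper) = subst (_≤ _) (sym (weight-⊤ f c))
  -- A fibre is independent: adjacent vertices in it would share a colour.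
  (sum≤fromℕ* (λ i → weight f (fibre c i)) (α f G) λ i → weight≤α f G λ x y x∈ y∈ xy →
    proper x y xy (trans (∈fibre⇒≡ c x∈) (sym (∈fibre⇒≡ c y∈))))

p≤q*r⇒p÷r≤q : ∀ p q r .{{_ : Positive r}} → p ≤ q * r → (p ÷ r) {{ℚ.pos⇒nonZero r}} ≤ q
p≤q*r⇒p÷r≤q p q r p≤qr = ℚ.*-cancelʳ-≤-pos r (begin
  p * 1/ r * r      ≡⟨ ℚ.*-assoc p (1/ r) r ⟩
  p * (1/ r * r)    ≡⟨ cong (p *_) (ℚ.*-inverseˡ r) ⟩
  p * 1ℚ            ≡⟨ ℚ.*-identityʳ p ⟩
  p                 ≤⟨ p≤qr ⟩
  q * r             ∎)
  where
  open ℚ.≤-Reasoning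
  instance _ = ℚ.pos⇒nonZero r

α-positive : .{{_ : NonZero n}} (f : Fin n → ℚ) → (∀ v → 0ℚ < f v) →
             (G : Graph n) → Positive (α f G)
α-positive f f>0 G = ℚ.nonNeg∧nonZero⇒pos (α f G)
  {{weight-nonNeg f f>0 (maxIndependent f G)}} {{α-nonZero f f>0 G}}

-- `G` is its own induced subgraph along the identity; the adjacency is the same by computation,
-- hence so are `ω` and `Colourable`.
perfect⇒ω-colourable : (G : Graph n) → Perfect G → Colourable G (ω G)
perfect⇒ω-colourable G perfect =
  subst (Colourable G) (perfect (↣-id _)) (χ-colourable (induced G (↣-id _)))

theorem3 : {n : ℕ} .{{_ : NonZero n}} (H : Graph n) → Perfect H →
    (f : Fin n → ℚ) (f>0 : ∀ v → 0ℚ < f v) →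
    + ω H ≥ ceiling (_÷_ (weight f ⊤) (α f H) {{α-nonZero f f>0 H}})
theorem3 H perfect f f>0 = ceiling≤ (ω H) _
  -- The quotient here carries a different proof that `α f H` is nonzero; that argument of `_÷_` is
  -- irrelevant, so the two quotients agree.
  (p≤q*r⇒p÷r≤q (weight f ⊤) (fromℕ (ω H)) (α f H) {{α-positive f f>0 H}}
    (weight≤colours*α f H (perfect⇒ω-colourable H perfect)))
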